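{- For all integers $n\ge 1$, $$F_{n+1}^2=3F_n^2-F^2_{n-1}+2(-1)^n .$$
   Context: The Fibonacci numbers are $F_0=0$, $F_1=1$, $F_n=F_{n-1}+F_{n-2}$ for $n\ge2$. -}

module Defs where

open import Data.Nat using (ℕ; zero; suc; _+_)

F : ℕ → ℕ
F zero          = 0
F (suc zero)    = 1
F (suc (suc n)) = F (suc n) + F n

{-# OPTIONS --safe #-}
-- Replacing F (n + 1) by F n + F (n - 1) and cancelling 2 turns the claim into Cassini's identity
-- F (n - 1) ² + F (n - 1) F n − F n ² = (-1) ^ n, whose left side changes sign when n increases by one.
module Submission where

open import Defs
open import Data.Nat as ℕ using (ℕ; _≥_; _∸_)
open import Data.Nat.Properties using (+-comm)
open import Data.Integer using (ℤ; +_; -1ℤ; _+_; _-_; _*_; _^_)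
open import Data.Integer.Tactic.RingSolver using (solve-∀)
open import Relation.Binary.PropositionalEquality using (_≡_; refl; cong; trans)

-- This is the norm of `a + b φ` in ℤ[φ], where φ is the golden ratio.
cassiniForm : ℤ → ℤ → ℤ
cassiniForm a b = a * a + a * b - b * b

-- Passing from `(a , b)` to `(b , b + a)` is multiplication by φ, whose norm is -1.
cassiniForm-step : ∀ a b → cassiniForm b (b + a) ≡ -1ℤ * cassiniForm a b
cassiniForm-step = expanded
  where
  expanded : ∀ a b → b * b + b * (b + a) - (b + a) * (b + a) ≡ -1ℤ * (a * a + a * b - b * b)
  expanded = solve-∀

cassini : ∀ m → cassiniForm (+ F m) (+ F (ℕ.suc m)) ≡ -1ℤ ^ ℕ.suc m
-- The form at `(0 , 1)` is already -1, hence the exponent `suc m`.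
cassini ℕ.zero    = refl
cassini (ℕ.suc m) = trans (cassiniForm-step (+ F m) (+ F (ℕ.suc m))) (cong (-1ℤ *_) (cassini m))

square-+ : ∀ a b → (b + a) ^ 2 ≡ (+ 3) * b ^ 2 - a ^ 2 + (+ 2) * cassiniForm a b
square-+ = expanded
  where
  -- The ring solver does not interpret integer powers; x ^ 2 unfolds to x * (x * + 1).
  expanded : ∀ a b → (b + a) * ((b + a) * + 1) ≡
    (+ 3) * (b * (b * + 1)) - a * (a * + 1) + (+ 2) * (a * a + a * b - b * b)
  expanded = solve-∀

mainTheorem8 : ∀ (n : ℕ) → n ≥ 1 →
    (+ F (n ℕ.+ 1)) ^ 2 ≡ (+ 3) * (+ F n) ^ 2 - (+ F (n ∸ 1)) ^ 2 + (+ 2) * -1ℤ ^ n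
-- Turning `m + 1` into `suc m` lets `F (suc (suc m))` unfold by the recurrence.
mainTheorem8 (ℕ.suc m) _ rewrite +-comm m 1 =
  trans (square-+ (+ F m) (+ F (ℕ.suc m)))
        (cong (λ e → (+ 3) * (+ F (ℕ.suc m)) ^ 2 - (+ F m) ^ 2 + (+ 2) * e) (cassini m))
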